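{- For every digraph $D$ with $w(P(D))\ge 2$, one has $l^*(D)\le w(P(D))$.
   Context: A digraph $D$ is finite with nonempty vertex set $V(D)$; loops are allowed, no multiple edges. Trees are finite; a leaf is a vertex of degree 1. Subtrees are nonempty connected subgraphs. A catch-tree representation of $D$ in a host tree $T$ assigns to each vertex $v$ of $D$ a subtree $S_v$ of $T$ (source subtree) and a single vertex $t_v$ of $T$ (sink point) such that, for all $u,v\in V(D)$ (including $u=v$), $uv$ is an edge of $D$ if and only if $t_v\in S_u$. The catch leafage $l^*(D)$ is the minimum number of leaves of a host tree in which $D$ has a catch-tree representation. The incidence poset $P(D)$ is the collection of predecessor sets $N^-(v)=\{u\in V(D): uv\in E(D)\}$, $v\in V(D)$, ordered by inclusion (these are the sets whose incidence vectors are the columns of the adjacency matrix; equal sets give one element). The width $w(P)$ of a poset $P$ is the maximum size of an antichain in $P$. -}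

module Defs where

open import Data.Bool using (Bool; true; false; T)
open import Data.Empty using (⊥)
open import Data.Fin using (Fin; zero; suc; inject₁; fromℕ)
open import Data.Fin.Subset using (Subset; _∈_; Nonempty; ∣_∣)
open import Data.Fin.Subset.Properties using (⊆-poset)
open import Data.Nat using (ℕ; zero; suc; _+_; _≤_; _<_; NonZero)
open import Data.Nat.Induction using (<-rec)
open import Data.Nat.Properties using (_≟_; ≮⇒≥)
open import Data.Product using (Σ-syntax; ∃; ∃-syntax; _×_; _,_; proj₁; proj₂)
open import Data.Unit using (tt)
open import Data.Vec using (tabulate)
open import Data.Vec.Properties using (lookup∘tabulate; []=⇒lookup; lookup⇒[]=)
open import Function.Bundles using (_⇔_; mk⇔; module Equivalence)
open import Function.Definitions using (Injective)
open import Level using (Level; 0ℓ; _⊔_)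
open import Relation.Binary using (Poset; Rel)
open import Relation.Binary.Construct.Closure.ReflexiveTransitive using (Star; ε; _◅_)
import Relation.Binary.Construct.On as On
open import Relation.Binary.PropositionalEquality using (_≡_; _≢_; refl; sym; trans; subst)
open import Relation.Nullary using (¬_)
open import Relation.Nullary.Decidable using (⌊_⌋)

private variable
  a ℓ₁ ℓ₂ : Level

IsLeast : (ℕ → Set a) → ℕ → Set a
IsLeast P k = P k × (∀ j → P j → k ≤ j)

IsGreatest : (ℕ → Set a) → ℕ → Set a
IsGreatest P k = P k × (∀ j → P j → j ≤ k)

------------------------------------------------------------------------
-- Posets

-- Distinct indices have incomparable values, so the values are pairwise
-- distinct for the poset's equality and k is the size of the antichain.
record Antichain (P : Poset a ℓ₁ ℓ₂) (k : ℕ) : Set (a ⊔ ℓ₂) where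
  open Poset P using (Carrier) renaming (_≤_ to _≼_)
  field
    element      : Fin k → Carrier
    incomparable : ∀ i j → i ≢ j → ¬ (element i ≼ element j)

IsWidth : Poset a ℓ₁ ℓ₂ → ℕ → Set (a ⊔ ℓ₂)
IsWidth P = IsGreatest (Antichain P)

------------------------------------------------------------------------
-- Digraphs

record Digraph : Set where
  field
    order        : ℕ
    .{{nonEmpty}} : NonZero order
    edge         : Fin order → Fin order → Bool

  Vertex : Set
  Vertex = Fin order

  Edge : Rel Vertex 0ℓ
  Edge u v = T (edge u v)

  N⁻ : Vertex → Subset order
  N⁻ v = tabulate (λ u → edge u v)

-- The equality and order are those of the underlying subsets, so vertices
-- with the same predecessor set give the same element.
incidencePoset : Digraph → Poset 0ℓ 0ℓ 0ℓ
incidencePoset D = On.poset (⊆-poset order) (proj₁ {B = IsPredecessorSet})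
  where
  open Digraph D
  IsPredecessorSet : Subset order → Set
  IsPredecessorSet X = ∃[ v ] X ≡ N⁻ v

------------------------------------------------------------------------
-- Trees

record Graph : Set where
  field
    order : ℕ
    adj   : Fin order → Fin order → Bool

  Vertex : Set
  Vertex = Fin order

  Adj : Rel Vertex 0ℓ
  Adj x y = T (adj x y)

  field
    symmetric   : ∀ {x y} → Adj x y → Adj y x
    irreflexive : ∀ {x} → ¬ Adj x x

  degree : Vertex → ℕ
  degree x = ∣ tabulate (adj x) ∣

  leaves : Subset order
  leaves = tabulate (λ x → ⌊ degree x ≟ 1 ⌋)

  leafCount : ℕ
  leafCount = ∣ leaves ∣

  -- A cycle of length 3 + k.
  record Cycle (k : ℕ) : Set where
    field
      vertex   : Fin (3 + k) → Vertex
      distinct : Injective _≡_ _≡_ vertex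
      step     : ∀ (i : Fin (2 + k)) → Adj (vertex (inject₁ i)) (vertex (suc i))
      close    : Adj (vertex (fromℕ (2 + k))) (vertex zero)

record Tree : Set where
  field
    graph : Graph
  open Graph graph public
  field
    .{{nonEmpty}} : NonZero order
    connected    : ∀ x y → Star Adj x y
    acyclic      : ∀ k → ¬ Cycle k

record Subtree (H : Tree) : Set where
  open Tree H using (order; Vertex; Adj)
  field
    vertices : Subset order
    edges    : Vertex → Vertex → Bool

  Edge : Rel Vertex 0ℓ
  Edge x y = T (edges x y)

  field
    symmetric : ∀ {x y} → Edge x y → Edge y x
    edge⇒adj  : ∀ {x y} → Edge x y → Adj x y
    edge⇒∈    : ∀ {x y} → Edge x y → x ∈ vertices × y ∈ vertices
    nonempty  : Nonempty vertices
    connected : ∀ {x y} → x ∈ vertices → y ∈ vertices → Star Edge x y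

------------------------------------------------------------------------
-- Catch-tree representations

record CatchTreeRepresentation (D : Digraph) (H : Tree) : Set where
  open Digraph D using (Vertex; Edge)
  field
    source : Vertex → Subtree H
    sink   : Vertex → Tree.Vertex H
    catch  : ∀ u v → Edge u v ⇔ (sink v ∈ Subtree.vertices (source u))

HasHostTree : Digraph → ℕ → Set
HasHostTree D k = Σ[ H ∈ Tree ] CatchTreeRepresentation D H × Tree.leafCount H ≡ k

IsCatchLeafage : Digraph → ℕ → Set
IsCatchLeafage D = IsLeast (HasHostTree D)

------------------------------------------------------------------------
-- Every digraph has a representation in a star, so the minimum defining the
-- catch leafage is over a nonempty set. A minimum of a nonempty set of naturals
-- exists only up to ¬¬ when membership in the set is not known to be decidable.

private
  ∈-tabulate : ∀ {n} (f : Fin n → Bool) i → T (f i) ⇔ (i ∈ tabulate f)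
  ∈-tabulate f i = mk⇔
    (λ t → lookup⇒[]= i _ (trans (lookup∘tabulate f i) (T⇒≡ (f i) t)))
    (λ p → subst T (trans (sym ([]=⇒lookup p)) (lookup∘tabulate f i)) tt)
    where
    T⇒≡ : ∀ b → T b → b ≡ true
    T⇒≡ true _ = refl

  module StarTree (n : ℕ) where
    adj : Fin (suc n) → Fin (suc n) → Bool
    adj zero    zero    = false
    adj zero    (suc _) = true
    adj (suc _) zero    = true
    adj (suc _) (suc _) = false

    symm : ∀ x y → T (adj x y) → T (adj y x)
    symm zero    (suc _) _ = tt
    symm (suc _) zero    _ = tt

    irrefl : ∀ x → ¬ T (adj x x)
    irrefl zero    ()
    irrefl (suc _) ()

    starGraph : Graph
    starGraph = record
      { order       = suc n
      ; adj         = adj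
      ; symmetric   = λ {x} {y} → symm x y
      ; irreflexive = λ {x} → irrefl x
      }

    open Graph starGraph using (Adj; Cycle)

    toCentre : ∀ {x y} → Adj x y → x ≢ zero → y ≡ zero
    toCentre {zero}          _ x≢0 with () ← x≢0 refl
    toCentre {suc _} {zero}  _ _   = refl

    fromCentre : ∀ {x y} → Adj x y → x ≡ zero → y ≢ zero
    fromCentre {x} a refl refl = irrefl x a

    noCycle : ∀ k → ¬ Cycle k
    noCycle k c = go (vertex zero) refl
      where
      open Cycle c
      0≢2 : _≢_ {A = Fin (3 + k)} zero (suc (suc zero))
      0≢2 ()
      go : ∀ x → vertex zero ≡ x → ⊥
      go zero    e = 0≢2 (distinct (trans e (sym (toCentre (step (suc zero))
                       (fromCentre (step zero) e)))))
      go (suc _) e = last≢1 (distinct (trans last≡0 (sym one≡0)))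
        where
        v₀≢0 : vertex zero ≢ zero
        v₀≢0 p with () ← trans (sym e) p
        one≡0 : vertex (suc zero) ≡ zero
        one≡0 = toCentre (step zero) v₀≢0
        last≡0 : vertex (fromℕ (2 + k)) ≡ zero
        last≡0 = toCentre (symm _ (vertex zero) close) v₀≢0
        last≢1 : fromℕ (2 + k) ≢ suc zero
        last≢1 ()

    connect : ∀ x y → Star Adj x y
    connect zero    zero    = ε
    connect zero    (suc _) = tt ◅ ε
    connect (suc _) zero    = tt ◅ ε
    connect (suc _) (suc _) = _◅_ {j = zero} tt (tt ◅ ε)

    starTree : Tree
    starTree = record { graph = starGraph ; connected = connect ; acyclic = noCycle }

    module Around (f : Fin n → Bool) where
      inside : Fin (suc n) → Bool
      inside zero    = true
      inside (suc i) = f i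

      edges : Fin (suc n) → Fin (suc n) → Bool
      edges zero    zero    = false
      edges zero    (suc j) = f j
      edges (suc i) zero    = f i
      edges (suc _) (suc _) = false

      edges-sym : ∀ x y → T (edges x y) → T (edges y x)
      edges-sym zero    (suc _) t = t
      edges-sym (suc _) zero    t = t

      edges-adj : ∀ x y → T (edges x y) → Adj x y
      edges-adj zero    (suc _) _ = tt
      edges-adj (suc _) zero    _ = tt

      edges-inside : ∀ x y → T (edges x y) → T (inside x)
      edges-inside zero    (suc _) _ = tt
      edges-inside (suc _) zero    t = t

      link : ∀ x y → T (inside x) → T (inside y) → Star (λ x y → T (edges x y)) x y
      link zero    zero    _ _ = ε
      link zero    (suc _) _ t = t ◅ ε
      link (suc _) zero    s _ = s ◅ ε
      link (suc _) (suc _) s t = _◅_ {j = zero} s (t ◅ ε)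

      open Equivalence

      subtree : Subtree starTree
      subtree = record
        { vertices  = tabulate inside
        ; edges     = edges
        ; symmetric = λ {x} {y} → edges-sym x y
        ; edge⇒adj  = λ {x} {y} → edges-adj x y
        ; edge⇒∈    = λ {x} {y} t →
            to (∈-tabulate inside x) (edges-inside x y t) ,
            to (∈-tabulate inside y) (edges-inside y x (edges-sym x y t))
        ; nonempty  = zero , to (∈-tabulate inside zero) tt
        ; connected = λ {x} {y} p q →
            link x y (from (∈-tabulate inside x) p) (from (∈-tabulate inside y) q)
        }

  ¬¬-least : ∀ (P : ℕ → Set) k → P k → ¬ ¬ ∃ (IsLeast P)
  ¬¬-least P k pk none = <-rec (λ j → ¬ P j) smaller k pk
    where
    smaller : ∀ j → (∀ {i} → i < j → ¬ P i) → ¬ P j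
    smaller j below pj = none (j , pj , λ i pi → ≮⇒≥ (λ i<j → below i<j pi))

starRepresentation : (D : Digraph) → ∃ (HasHostTree D)
starRepresentation D = _ , starTree , rep , refl
  where
  open Digraph D
  open StarTree order
  rep : CatchTreeRepresentation D starTree
  rep = record
    { source = λ u → Around.subtree (edge u)
    ; sink   = suc
    ; catch  = λ u v → ∈-tabulate (Around.inside (edge u)) (suc v)
    }

catchLeafage-exists : (D : Digraph) → ¬ ¬ ∃ (IsCatchLeafage D)
catchLeafage-exists D with k , r ← starRepresentation D = ¬¬-least (HasHostTree D) k r

{-# OPTIONS --safe #-}

-- By Dilworth's theorem the predecessor sets split into w chains. The host is
-- the spider with w legs, one for each chain, in which a vertex v is placed on
-- the leg of its chain, nearer to the centre the larger N⁻ v is. The sinks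
-- caught by a vertex u then are, on every leg, those of an initial segment. As 2 ≤ w, the centre is not a
-- leaf.
module Submission where

open import Defs
open import Data.Bool using (Bool; true; false; T; _∧_; _∨_)
open import Data.Bool.Properties using (T-≡; T-∧; T-∨)
open import Data.Fin using (Fin; zero; suc; toℕ; fromℕ; fromℕ<; inject₁; inject≤; combine; remQuot; punchOut; finToFun; funToFin)
open import Data.Fin.Properties using (_≟_; ¬Fin0; all?; any?; toℕ-fromℕ<; toℕ-inject₁; inject≤-injective; injective⇒≤; punchOut-injective; finToFun-funToFin; combine-monoˡ-<; combine-injectiveʳ; combine-surjective; remQuot-combine; suc-injective)
open import Data.Fin.Relation.Unary.Top using (view; ‵fromℕ; ‵inject₁)
open import Data.Fin.Subset using (Subset; _∈_; _∉_; _⊆_; _⊂_; ⊤; ⁅_⁆; _─_; _-_; ∣_∣; outside; inside)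
open import Data.Fin.Subset.Induction using (⊂-wellFounded)
open import Data.Fin.Subset.Properties using (_∈?_; _⊆?_; Empty-unique; ∣⊥∣≡0; nonempty?; ⊆-refl; ⊆-trans; ∈⊤; x∈⁅x⁆; x∈⁅y⁆⇒x≡y; ∣p∣≤n; p─q⊆p; p─⊥≡p; p⊂q⇒∣p∣<∣q∣; p∩q≢∅⇒p─q⊂p; x∈p∩q⁺; x∈p∧x∉q⇒x∈p─q; x∈p∧x≢y⇒x∈p-y; x∈p⇒p-x⊂p; x∈p⇒∣p-x∣<∣p∣)
open import Data.Nat using (ℕ; zero; suc; _*_; _^_; _∸_; _≤_; _<_; z≤n; s≤s)
import Data.Nat as ℕ
import Data.Nat.Properties as ℕ
open import Data.Nat.Induction using (<-wellFounded)
open import Data.Product using (∃; ∃-syntax; Σ-syntax; _×_; _,_; proj₁; proj₂; uncurry)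
open import Data.Sum using (_⊎_; inj₁; inj₂; swap; [_,_]′)
open import Data.Unit using (tt) renaming (⊤ to Unit)
open import Data.Vec using (tabulate; _∷_; here; there)
open import Data.Vec.Functional using () renaming (_∷_ to _◂_)
open import Data.Vec.Properties using (lookup∘tabulate; []=⇒lookup; lookup⇒[]=)
open import Function using (_∘_; id; _on_)
open import Function.Bundles using (_⇔_; mk⇔; module Equivalence)
open import Function.Definitions using (Injective)
open import Induction.WellFounded using (Acc; acc)
open import Relation.Binary using (Rel; Reflexive; Transitive) renaming (Decidable to Decidable₂)
open import Relation.Binary.Construct.Closure.ReflexiveTransitive using (Star; ε; _◅_; _◅◅_; reverse; map)
open import Relation.Binary.PropositionalEquality using (_≡_; _≢_; refl; sym; trans; cong; subst)
open import Relation.Nullary using (¬_; Dec; yes; no; contradiction)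
open import Relation.Nullary.Decidable using (⌊_⌋; toWitness; fromWitness; ¬?; T?; _×-dec_; _⊎-dec_; _→-dec_)
open import Relation.Unary using (Pred; Decidable)

open Equivalence using (to; from)

-- Finite sets

∈-tabulate⁺ : ∀ {n} (f : Fin n → Bool) {i} → T (f i) → i ∈ tabulate f
∈-tabulate⁺ f {i} t = lookup⇒[]= i _ (trans (lookup∘tabulate f i) (to T-≡ t))

∈-tabulate⁻ : ∀ {n} (f : Fin n → Bool) {i} → i ∈ tabulate f → T (f i)
∈-tabulate⁻ f {i} p = from T-≡ (trans (sym (lookup∘tabulate f i)) ([]=⇒lookup p))

x∈p─q⇒x∉q : ∀ {n} (p q : Subset n) {x} → x ∈ p ─ q → x ∉ q
x∈p─q⇒x∉q (_ ∷ _) (outside ∷ _) here      ()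
x∈p─q⇒x∉q (_ ∷ p) (inside ∷ q)  (there i) (there j) = x∈p─q⇒x∉q p q i j
x∈p─q⇒x∉q (_ ∷ p) (outside ∷ q) (there i) (there j) = x∈p─q⇒x∉q p q i j

∣p∣≤1+∣p-x∣ : ∀ {n} (p : Subset n) x → ∣ p ∣ ≤ suc ∣ p - x ∣
∣p∣≤1+∣p-x∣ (outside ∷ p) zero    =
  ℕ.m≤n⇒m≤1+n (ℕ.≤-reflexive (sym (cong ∣_∣ (p─⊥≡p p))))
∣p∣≤1+∣p-x∣ (inside  ∷ p) zero    = s≤s (ℕ.≤-reflexive (sym (cong ∣_∣ (p─⊥≡p p))))
∣p∣≤1+∣p-x∣ (outside ∷ p) (suc x) = ∣p∣≤1+∣p-x∣ p x
∣p∣≤1+∣p-x∣ (inside  ∷ p) (suc x) = s≤s (∣p∣≤1+∣p-x∣ p x)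

-- Induction on `k`: deleting `f zero` costs at most one element and leaves a set covered by
-- `f ∘ suc`.
covered⇒∣p∣≤ : ∀ {n k} (p : Subset n) (f : Fin k → Fin n) →
               (∀ {x} → x ∈ p → ∃[ i ] x ≡ f i) → ∣ p ∣ ≤ k
covered⇒∣p∣≤ {n} {zero} p f cover
  rewrite Empty-unique {p = p} (λ (_ , x∈p) → ¬Fin0 (proj₁ (cover x∈p))) =
  ℕ.≤-reflexive (∣⊥∣≡0 n)
covered⇒∣p∣≤ {k = suc k} p f cover =
  ℕ.≤-trans (∣p∣≤1+∣p-x∣ p (f zero)) (s≤s (covered⇒∣p∣≤ (p - f zero) (f ∘ suc) rest))
  where
  rest : ∀ {x} → x ∈ p - f zero → ∃[ i ] x ≡ f (suc i)
  rest x∈ with cover (p─q⊆p p ⁅ f zero ⁆ x∈)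
  ... | zero  , refl = contradiction (x∈⁅x⁆ _) (x∈p─q⇒x∉q p _ x∈)
  ... | suc i , eq   = i , eq

two-elements⇒2≤∣p∣ : ∀ {n} {p : Subset n} {x y} → x ∈ p → y ∈ p → x ≢ y → 2 ≤ ∣ p ∣
two-elements⇒2≤∣p∣ x∈p y∈p x≢y =
  ℕ.≤-<-trans (ℕ.≤-trans (s≤s z≤n) (x∈p⇒∣p-x∣<∣p∣ (x∈p∧x≢y⇒x∈p-y x∈p x≢y)))
              (x∈p⇒∣p-x∣<∣p∣ y∈p)

-- A missed value `y` could be punched out of the codomain, leaving an injection from `Fin (suc k)`
-- into `Fin k`.
injective⇒surjective : ∀ {k} {f : Fin k → Fin k} → Injective _≡_ _≡_ f → ∀ y → ∃[ x ] f x ≡ y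
injective⇒surjective {suc k} {f} inj y with any? (λ x → f x ≟ y)
... | yes found = found
... | no  missed = contradiction
  (injective⇒≤ {f = λ x → punchOut (y≢f x)}
    (λ {i} {j} eq → inj (punchOut-injective (y≢f i) (y≢f j) eq)))
  (ℕ.<⇒≱ (ℕ.n<1+n k))
  where
  y≢f : ∀ x → y ≢ f x
  y≢f x eq = missed (x , sym eq)

-- Dilworth's theorem

module _ {a ℓ} {X : Set a} {_≼_ : Rel X ℓ} (≼-trans : Transitive _≼_) (_≼?_ : Decidable₂ _≼_) where

  -- In a preorder, maximal means that whatever lies above also lies below. Choosing among the
  -- values of `f` lets one search serve subsets, coded functions and the vertices of a cycle.
  maximal : ∀ {N p} {P : Pred (Fin N) p} → Decidable P → (f : Fin N → X) → ∃ P →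
            ∃[ i ] P i × (∀ j → P j → f i ≼ f j → f j ≼ f i)
  maximal {suc N} P? f (i , Pi) with any? (P? ∘ suc)
  maximal {suc N} P? f (zero  , P0) | no ¬tail =
    zero , P0 , λ { zero _ le → le ; (suc j) Pj _ → contradiction (j , Pj) ¬tail }
  maximal {suc N} P? f (suc i , Pi) | no ¬tail = contradiction (i , Pi) ¬tail
  maximal {suc N} P? f _ | yes tail with maximal (P? ∘ suc) (f ∘ suc) tail
  ... | m , Pm , max with P? zero ×-dec f (suc m) ≼? f zero
  ... | yes (P0 , le) = zero , P0 , λ where
    zero    _  le′ → le′
    (suc j) Pj le′ → ≼-trans (max j Pj (≼-trans le le′)) le
  ... | no  ¬0≽m = suc m , Pm , λ where
    zero    P0 le → contradiction (P0 , le) ¬0≽m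
    (suc j) → max j

-- Galvin's proof. A maximal element a is removed, the rest is covered by k
-- chains, and x i is the highest element of the i-th chain that lies on an
-- antichain of size k. The x i form an antichain. If none of them is below a,
-- then a extends this antichain; otherwise a and the part of the i-th chain up
-- to x i form a chain that meets every antichain of size k.
module Dilworth {n ℓ} (_≼_ : Rel (Fin n) ℓ) (≼-refl : Reflexive _≼_) (≼-trans : Transitive _≼_)
                (_≼?_ : Decidable₂ _≼_) where

  Comparable : Rel (Fin n) ℓ
  Comparable x y = x ≼ y ⊎ y ≼ x

  IsAntichain : ∀ {k} → Subset n → (Fin k → Fin n) → Set ℓ
  IsAntichain p A = (∀ i → A i ∈ p) × (∀ i j → i ≢ j → ¬ A i ≼ A j)

  -- Classes may overlap and may leave `p`, so a new chain can be added as it stands, without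
  -- trimming.
  record ChainCover (p : Subset n) (k : ℕ) : Set ℓ where
    field
      class  : Fin k → Subset n
      chain  : ∀ i {x y} → x ∈ class i → y ∈ class i → Comparable x y
      covers : ∀ {x} → x ∈ p → ∃[ i ] x ∈ class i

    index : ∀ {x} → x ∈ p → Fin k
    index = proj₁ ∘ covers

    same-index⇒comparable : ∀ {x y} (x∈p : x ∈ p) (y∈p : y ∈ p) →
                            index x∈p ≡ index y∈p → Comparable x y
    same-index⇒comparable {x} x∈p y∈p eq =
      chain _ (subst (λ i → x ∈ class i) eq (proj₂ (covers x∈p))) (proj₂ (covers y∈p))

    antichain-index-injective : ∀ {m} {A : Fin m → Fin n} (anti : IsAntichain p A) →
                                Injective _≡_ _≡_ (index ∘ proj₁ anti)
    antichain-index-injective (A∈p , incomp) {i} {j} eq with i ≟ j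
    ... | yes i≡j = i≡j
    ... | no  i≢j = contradiction (same-index⇒comparable (A∈p i) (A∈p j) eq)
                                  [ incomp i j i≢j , incomp j i (i≢j ∘ sym) ]′

    antichain⇒≤ : ∀ {m} {A : Fin m → Fin n} → IsAntichain p A → m ≤ k
    antichain⇒≤ anti = injective⇒≤ (antichain-index-injective anti)

    IsTransversal : (Fin k → Fin n) → Set ℓ
    IsTransversal A = IsAntichain p A × (∀ i → A i ∈ class i)

    transversal? : Decidable IsTransversal
    transversal? A =
      (all? (λ i → A i ∈? p) ×-dec
       all? (λ i → all? (λ j → ¬? (i ≟ j) →-dec ¬? (A i ≼? A j)))) ×-dec
      all? (λ i → A i ∈? class i)

    -- Serves the coding of functions by numbers, since `finToFun` inverts `funToFin` only
    -- pointwise.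
    transversal-≗ : ∀ {A B} → (∀ i → A i ≡ B i) → IsTransversal A → IsTransversal B
    transversal-≗ {A} {B} eq ((A∈p , incomp) , A∈class) =
      ( (λ i → subst (_∈ p) (eq i) (A∈p i))
      , (λ i j i≢j Bi≼Bj → incomp i j i≢j
           (subst (A i ≼_) (sym (eq j)) (subst (_≼ B j) (sym (eq i)) Bi≼Bj)))) ,
      (λ i → subst (_∈ class i) (eq i) (A∈class i))

    -- By pigeonhole, an antichain with as many members as there are classes has exactly one member
    -- of each index; `σ` inverts its index map.
    reindex : ∀ {A} → IsAntichain p A → ∃[ σ ] IsTransversal (A ∘ σ)
    reindex {A} anti@(A∈p , incomp) =
      σ , ( A∈p ∘ σ
          , (λ i j i≢j → incomp (σ i) (σ j)
               (λ eq → i≢j (trans (sym (σ-index i)) (trans (cong (index ∘ A∈p) eq) (σ-index j)))))) ,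
      λ i → subst (λ l → A (σ i) ∈ class l) (σ-index i) (proj₂ (covers (A∈p (σ i))))
      where
      surj : ∀ i → ∃[ j ] index (A∈p j) ≡ i
      surj = injective⇒surjective (antichain-index-injective anti)
      σ : Fin k → Fin k
      σ = proj₁ ∘ surj
      σ-index : ∀ i → index (A∈p (σ i)) ≡ i
      σ-index = proj₂ ∘ surj

    highest-antichain : ∀ {A : Fin k → Fin n} → IsAntichain p A →
      ∃[ x ] IsTransversal x × (∀ {B} → IsTransversal B → ∀ i → B i ≼ x i)
    highest-antichain {A} anti = x , ((x∈p , incomp) , x∈class) , ≼x
      where
      -- Functions from `Fin k` to `Fin n` are coded by numbers below `n ^ k`, so that `maximal` can
      -- search them.
      P : Pred (Fin (n ^ k)) ℓ
      P = IsTransversal ∘ finToFun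

      encode : ∀ {B} → IsTransversal B → P (funToFin B)
      encode {B} = transversal-≗ (sym ∘ finToFun-funToFin B)

      top : ∀ i → ∃[ t ] P t × (∀ s → P s → finToFun t i ≼ finToFun s i → finToFun s i ≼ finToFun t i)
      top i = maximal ≼-trans _≼?_ (transversal? ∘ finToFun) (λ t → finToFun t i)
                (_ , encode (proj₂ (reindex anti)))

      transversal : Fin k → Fin k → Fin n
      transversal i = finToFun (proj₁ (top i))

      isTransversal : ∀ i → IsTransversal (transversal i)
      isTransversal i = proj₁ (proj₂ (top i))

      x : Fin k → Fin n
      x i = transversal i i

      x∈p : ∀ i → x i ∈ p
      x∈p i = proj₁ (proj₁ (isTransversal i)) i

      x∈class : ∀ i → x i ∈ class i
      x∈class i = proj₂ (isTransversal i) i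

      ≼x : ∀ {B} → IsTransversal B → ∀ i → B i ≼ x i
      -- Both entries lie in the chain `class i`, hence are comparable; if `B i` is the upper one,
      -- the choice of `top i` puts it below as well.
      ≼x {B} B-trans i with chain i (proj₂ B-trans i) (x∈class i)
      ... | inj₁ Bi≼xi = Bi≼xi
      ... | inj₂ xi≼Bi = subst (_≼ x i) eq
        (proj₂ (proj₂ (top i)) (funToFin B) (encode B-trans) (subst (x i ≼_) (sym eq) xi≼Bi))
        where
        eq : finToFun (funToFin B) i ≡ B i
        eq = finToFun-funToFin B i

      -- The transversal chosen for `j` has its `i`-th entry below `x i`. If `x i` were below `x j`,
      -- two entries of that one antichain would be comparable.
      incomp : ∀ i j → i ≢ j → ¬ x i ≼ x j
      incomp i j i≢j xi≼xj = proj₂ (proj₁ (isTransversal j)) i j i≢j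
        (≼-trans (≼x (isTransversal j) i) xi≼xj)

  open ChainCover

  addChain : ∀ {p q K : Subset n} {k} → (∀ {x y} → x ∈ K → y ∈ K → Comparable x y) →
             (∀ {x} → x ∈ p → x ∈ K ⊎ x ∈ q) → ChainCover q k → ChainCover p (suc k)
  addChain {p} {q} {K} {k} K-chain split C = record
    { class  = K ◂ class C
    ; chain  = λ { zero → K-chain ; (suc i) → chain C i }
    ; covers = λ x∈p → cover (split x∈p)
    }
    where
    cover : ∀ {x} → x ∈ K ⊎ x ∈ q → ∃[ i ] x ∈ (K ◂ class C) i
    cover (inj₁ x∈K) = zero , x∈K
    cover (inj₂ x∈q) = suc (index C x∈q) , proj₂ (covers C x∈q)

  -- The common size `k` certifies that both are optimal, since no antichain is larger than a chain
  -- cover.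
  HasDilworth : Subset n → Set ℓ
  HasDilworth p = ∃[ k ] ChainCover p k × Σ[ A ∈ (Fin k → Fin n) ] IsAntichain p A

  x∈p⇒x∈q⊎x∈p─q : ∀ {p x} (q : Subset n) → x ∈ p → x ∈ q ⊎ x ∈ p ─ q
  x∈p⇒x∈q⊎x∈p─q {x = x} q x∈p with x ∈? q
  ... | yes x∈q = inj₁ x∈q
  ... | no  x∉q = inj₂ (x∈p∧x∉q⇒x∈p─q x∈p x∉q)

  dilworth-step : ∀ {p a} → a ∈ p → (∀ x → x ∈ p → a ≼ x → x ≼ a) →
                  (∀ {q} → q ⊂ p → HasDilworth q) → HasDilworth p
  dilworth-step {p} {a} a∈p a-max rec
    with k , C , A , A-anti ← rec (x∈p⇒p-x⊂p a∈p)
    with x , ((x∈p-a , x-incomp) , x∈class) , ≼x ← highest-antichain C A-anti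
    with any? (λ i → x i ≼? a)
  ... | no a-alone =
    suc k ,
    addChain (λ y∈ z∈ → inj₁ (subst (_≼ _) (sym (x∈⁅y⁆⇒x≡y _ y∈))
                               (subst (a ≼_) (sym (x∈⁅y⁆⇒x≡y _ z∈)) ≼-refl)))
             (x∈p⇒x∈q⊎x∈p─q ⁅ a ⁆) C ,
    a ◂ x ,
    (λ { zero → a∈p ; (suc i) → x∈p i }) ,
    λ where
      zero    zero    0≢0 _    → 0≢0 refl
      zero    (suc j) _   a≼xj → a-alone (j , a-max _ (x∈p j) a≼xj)
      (suc i) zero    _   xi≼a → a-alone (i , xi≼a)
      (suc i) (suc j) i≢j xi≼xj → x-incomp i j (i≢j ∘ cong suc) xi≼xj
    where
    x∈p : ∀ i → x i ∈ p
    x∈p i = p─q⊆p p ⁅ a ⁆ (x∈p-a i)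
  -- The recursive call on `p ─ K` brings its own number `k′`. It equals `k` minus one: `p ─ K` has
  -- an antichain of size `k′` but none of size `k`, and `x` is an antichain in a set covered by
  -- `suc k′` chains.
  ... | yes (i , xi≼a) = k , subst (ChainCover p) (ℕ.≤-antisym k′<k k≤1+k′) C⁺ , x , x-anti
    where
    x-anti : IsAntichain p x
    x-anti = p─q⊆p p ⁅ a ⁆ ∘ x∈p-a , x-incomp

    inK? : Decidable (λ y → y ≡ a ⊎ (y ∈ class C i × y ≼ x i))
    inK? y = y ≟ a ⊎-dec (y ∈? class C i ×-dec y ≼? x i)

    K : Subset n
    K = tabulate (λ y → ⌊ inK? y ⌋)

    ∈K⁺ : ∀ {y} → y ≡ a ⊎ (y ∈ class C i × y ≼ x i) → y ∈ K
    ∈K⁺ = ∈-tabulate⁺ _ ∘ fromWitness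

    ∈K⁻ : ∀ {y} → y ∈ K → y ≡ a ⊎ (y ∈ class C i × y ≼ x i)
    ∈K⁻ y∈K = toWitness (∈-tabulate⁻ (λ y → ⌊ inK? y ⌋) y∈K)

    K-chain : ∀ {y z} → y ∈ K → z ∈ K → Comparable y z
    K-chain y∈K z∈K with ∈K⁻ y∈K | ∈K⁻ z∈K
    ... | inj₁ refl         | inj₁ refl         = inj₁ ≼-refl
    ... | inj₁ refl         | inj₂ (_ , z≼xi)   = inj₂ (≼-trans z≼xi xi≼a)
    ... | inj₂ (_ , y≼xi)   | inj₁ refl         = inj₁ (≼-trans y≼xi xi≼a)
    ... | inj₂ (y∈c , _)    | inj₂ (z∈c , _)    = chain C i y∈c z∈c

    p─K⊂p : p ─ K ⊂ p
    p─K⊂p = p∩q≢∅⇒p─q⊂p p K (a , x∈p∩q⁺ (a∈p , ∈K⁺ (inj₁ refl)))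

    k′ : ℕ
    k′ = proj₁ (rec p─K⊂p)

    C⁺ : ChainCover p (suc k′)
    C⁺ = addChain K-chain (x∈p⇒x∈q⊎x∈p─q K) (proj₁ (proj₂ (rec p─K⊂p)))

    k≤1+k′ : k ≤ suc k′
    k≤1+k′ = antichain⇒≤ C⁺ x-anti

    -- Such a `B` avoids `a`, so it can be arranged as a transversal of `C`; its member in the
    -- `i`-th class is then below `x i`, hence in `K`.
    no-k-antichain : ∀ {B : Fin k → Fin n} → ¬ IsAntichain (p ─ K) B
    no-k-antichain {B} (B∈ , B-incomp)
      with σ , Bσ-trans ← reindex C {A = B}
        ( (λ j → x∈p∧x≢y⇒x∈p-y (p─q⊆p p K (B∈ j)) (λ eq → x∈p─q⇒x∉q p K (B∈ j) (∈K⁺ (inj₁ eq))))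
        , B-incomp) =
      x∈p─q⇒x∉q p K (B∈ (σ i)) (∈K⁺ (inj₂ (proj₂ Bσ-trans i , ≼x Bσ-trans i)))

    k′<k : suc k′ ≤ k
    k′<k with k ℕ.≤? k′ | proj₂ (proj₂ (rec p─K⊂p))
    ... | no  k≰k′ | _ = ℕ.≰⇒> k≰k′
    ... | yes k≤k′ | B , B∈ , B-incomp = contradiction
      ( (λ j → B∈ (inject≤ j k≤k′))
      , λ i j i≢j → B-incomp _ _ (i≢j ∘ inject≤-injective k≤k′ k≤k′ i j))
      no-k-antichain

  -- The induction is on strict inclusion, because the step recurses both after deleting one element
  -- and after deleting a whole chain.
  dilworth : ∀ p → HasDilworth p
  dilworth p = go p (⊂-wellFounded p)
    where
    go : ∀ p → Acc _⊂_ p → HasDilworth p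
    go p (acc smaller) with nonempty? p
    ... | no  empty = 0 ,
      record { class = λ () ; chain = λ () ; covers = λ x∈p → contradiction (_ , x∈p) empty } ,
      (λ ()) , (λ ()) , λ ()
    ... | yes ne with maximal ≼-trans _≼?_ (_∈? p) id ne
    ... | a , a∈p , a-max = dilworth-step a∈p a-max (λ {q} q⊂p → go q (smaller q⊂p))

-- Trees given by a parent function

-- `parent i` is the parent of the vertex `suc i`, so the bound makes numbers strictly decrease
-- towards the root `zero`.
module RootedTree {n} (parent : Fin n → Fin (suc n)) (parent≤ : ∀ i → toℕ (parent i) ≤ toℕ i) where

  childOf : Fin (suc n) → Fin (suc n) → Bool
  childOf zero    _ = false
  childOf (suc i) y = ⌊ parent i ≟ y ⌋

  adj : Fin (suc n) → Fin (suc n) → Bool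
  adj x y = childOf x y ∨ childOf y x

  childOf⇒< : ∀ x y → T (childOf x y) → toℕ y < toℕ x
  childOf⇒< (suc i) y t with refl ← toWitness {a? = parent i ≟ y} t = s≤s (parent≤ i)

  childOf-functional : ∀ x {y z} → T (childOf x y) → T (childOf x z) → y ≡ z
  childOf-functional (suc i) {y} {z} s t =
    trans (sym (toWitness {a? = parent i ≟ y} s)) (toWitness {a? = parent i ≟ z} t)

  adj-sym : ∀ {x y} → T (adj x y) → T (adj y x)
  adj-sym {x} {y} = from (T-∨ {childOf y x}) ∘ swap ∘ to (T-∨ {childOf x y})

  adj-parent : ∀ i → T (adj (suc i) (parent i))
  adj-parent i = from (T-∨ {childOf (suc i) (parent i)}) (inj₁ (fromWitness {a? = parent i ≟ parent i} refl))

  adj-irrefl : ∀ {x} → ¬ T (adj x x)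
  adj-irrefl {x} t = [ loopless , loopless ]′ (to (T-∨ {childOf x x}) t)
    where
    loopless : ¬ T (childOf x x)
    loopless c = ℕ.<-irrefl refl (childOf⇒< x x c)

  lower-neighbour : ∀ {x y} → T (adj x y) → toℕ y ≤ toℕ x → T (childOf x y)
  lower-neighbour {x} {y} t y≤x with to (T-∨ {childOf x y}) t
  ... | inj₁ c = c
  ... | inj₂ c = contradiction y≤x (ℕ.<⇒≱ (childOf⇒< y x c))

  graph : Graph
  graph = record
    { order       = suc n
    ; adj         = adj
    ; symmetric   = λ {x} {y} → adj-sym {x} {y}
    ; irreflexive = λ {x} → adj-irrefl {x}
    }

  open Graph graph using (Adj; Cycle; degree; leaves; leafCount)

  module _ {k} (c : Cycle k) where
    open Cycle c

    -- The closing edge supplies the second neighbour at both ends; the two differ there because a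
    -- cycle has length at least three.
    cycle-neighbours : ∀ i →
      ∃[ a ] ∃[ b ] a ≢ b × Adj (vertex i) (vertex a) × Adj (vertex i) (vertex b)
    cycle-neighbours zero =
      suc zero , fromℕ _ , (λ ()) , step zero , adj-sym {vertex (fromℕ _)} close
    cycle-neighbours (suc j) with view j
    ... | ‵fromℕ      = inject₁ j , zero , (λ ()) , adj-sym {vertex (inject₁ j)} (step j) , close
    ... | ‵inject₁ j′ = inject₁ j , suc (suc j′) , distinct-sides ,
      adj-sym {vertex (inject₁ j)} (step j) , step (suc j′)
      where
      distinct-sides : inject₁ (inject₁ j′) ≢ suc (suc j′)
      distinct-sides eq = ℕ.<⇒≢ (ℕ.m<n⇒m<1+n (ℕ.n<1+n (toℕ j′)))
        (trans (sym (trans (toℕ-inject₁ (inject₁ j′)) (toℕ-inject₁ j′))) (cong toℕ eq))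

  -- Both neighbours of the largest vertex of a cycle would be its parent.
  acyclic : ∀ k → ¬ Cycle k
  acyclic k c
    with i , _ , i-max ← maximal ℕ.≤-trans ℕ._≤?_ {P = λ _ → Unit} (λ _ → yes tt)
                               (toℕ ∘ Cycle.vertex c) (zero , tt)
    with a , b , a≢b , adj-a , adj-b ← cycle-neighbours c i =
    a≢b (distinct (childOf-functional (vertex i) (is-parent adj-a) (is-parent adj-b)))
    where
    open Cycle c
    is-parent : ∀ {a} → Adj (vertex i) (vertex a) → T (childOf (vertex i) (vertex a))
    is-parent {a} adj-a with ℕ.≤-total (toℕ (vertex i)) (toℕ (vertex a))
    ... | inj₁ le = lower-neighbour adj-a (i-max a tt le)
    ... | inj₂ ge = lower-neighbour adj-a ge

  -- From each vertex of such a set the path of parents reaches the root inside the set, so the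
  -- induced subgraph is connected. The set of all vertices gives the connectedness of the tree
  -- itself.
  module Rooted (f : Fin (suc n) → Bool) (f-root : T (f zero))
                (f-parent : ∀ i → T (f (suc i)) → T (f (parent i))) where

    edges : Fin (suc n) → Fin (suc n) → Bool
    edges x y = adj x y ∧ (f x ∧ f y)

    edges⁻ : ∀ {x y} → T (edges x y) → T (adj x y) × T (f x) × T (f y)
    edges⁻ {x} {y} t with s , r ← to (T-∧ {adj x y}) t = s , to (T-∧ {f x}) r

    edges⁺ : ∀ {x y} → T (adj x y) → T (f x) → T (f y) → T (edges x y)
    edges⁺ {x} {y} s p q = from (T-∧ {adj x y}) (s , from (T-∧ {f x}) (p , q))

    edges-sym : ∀ {x y} → T (edges x y) → T (edges y x)
    edges-sym {x} {y} t with s , p , q ← edges⁻ {x} {y} t = edges⁺ {y} {x} (adj-sym {x} {y} s) q p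

    Edge : Rel (Fin (suc n)) _
    Edge x y = T (edges x y)

    to-root : ∀ x → T (f x) → Star Edge x zero
    to-root x = go x (<-wellFounded (toℕ x))
      where
      go : ∀ x → Acc _<_ (toℕ x) → T (f x) → Star Edge x zero
      go zero    _         _ = ε
      go (suc i) (acc smaller) t =
        edges⁺ {suc i} {parent i} (adj-parent i) t (f-parent i t) ◅
        go (parent i) (smaller (s≤s (parent≤ i))) (f-parent i t)

    connected : ∀ x y → T (f x) → T (f y) → Star Edge x y
    connected x y p q = to-root x p ◅◅ reverse (λ {x} {y} → edges-sym {x} {y}) (to-root y q)

  tree : Tree
  tree = record
    { graph     = graph
    ; connected = λ x y → map (λ {x} {y} → proj₁ ∘ All.edges⁻ {x} {y}) (All.connected x y tt tt)
    ; acyclic   = acyclic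
    }
    where module All = Rooted (λ _ → true) tt (λ _ _ → tt)

  rootedSubtree : (f : Fin (suc n) → Bool) → T (f zero) →
                  (∀ i → T (f (suc i)) → T (f (parent i))) → Subtree tree
  rootedSubtree f f-root f-parent = record
    { vertices  = tabulate f
    ; edges     = edges
    ; symmetric = λ {x} {y} → edges-sym {x} {y}
    ; edge⇒adj  = λ {x} {y} → proj₁ ∘ edges⁻ {x} {y}
    ; edge⇒∈    = λ {x} {y} t → let _ , p , q = edges⁻ {x} {y} t in ∈-tabulate⁺ f p , ∈-tabulate⁺ f q
    ; nonempty  = zero , ∈-tabulate⁺ f f-root
    ; connected = λ p q → connected _ _ (∈-tabulate⁻ f p) (∈-tabulate⁻ f q)
    }
    where open Rooted f f-root f-parent

  two-neighbours⇒¬leaf : ∀ {x y z} → Adj x y → Adj x z → y ≢ z → x ∉ leaves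
  two-neighbours⇒¬leaf {x} s t y≢z leaf = ℕ.<⇒≢
    (two-elements⇒2≤∣p∣ (∈-tabulate⁺ (adj x) s) (∈-tabulate⁺ (adj x) t) y≢z)
    (sym (toWitness {a? = degree x ℕ.≟ 1} (∈-tabulate⁻ (λ x → ⌊ degree x ℕ.≟ 1 ⌋) leaf)))

-- The centre is zero, and place j i is the node at distance 1 + j from it on
-- the leg i. All legs have the same length; not every node need be a sink.
module Spider (w m : ℕ) where

  Node : Set
  Node = Fin (suc (suc m * w))

  place : Fin (suc m) → Fin w → Node
  place j i = suc (combine j i)

  inward : Fin (suc m) → Fin w → Node
  inward zero    _ = zero
  inward (suc j) i = place (inject₁ j) i

  parent : Fin (suc m * w) → Node
  parent = uncurry inward ∘ remQuot {suc m} w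

  parent-combine : ∀ j i → parent (combine j i) ≡ inward j i
  parent-combine j i = cong (uncurry inward) (remQuot-combine {suc m} j i)

  -- `combine j i` has the value `j * w + i`: nodes are numbered by distance first, so stepping
  -- inward lowers the number.
  inward≤ : ∀ j i → toℕ (inward j i) ≤ toℕ (combine j i)
  inward≤ zero    _ = z≤n
  inward≤ (suc j) i = combine-monoˡ-< i i (s≤s (ℕ.≤-reflexive (toℕ-inject₁ j)))

  parent≤ : ∀ v → toℕ (parent v) ≤ toℕ v
  parent≤ v with j , i , refl ← combine-surjective {suc m} v =
    subst (λ x → toℕ x ≤ toℕ (combine j i)) (sym (parent-combine j i)) (inward≤ j i)

  open RootedTree parent parent≤ public
  open Graph graph using (Adj; leaves; leafCount)

  adj-inward : ∀ j i → Adj (place j i) (inward j i)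
  adj-inward j i = subst (Adj (place j i)) (parent-combine j i) (adj-parent (combine j i))

  adj-outward : ∀ j i → Adj (inward j i) (place j i)
  adj-outward j i = adj-sym {place j i} (adj-inward j i)

  -- The centre has neighbours on two legs, and a node before the end of its leg has one on either
  -- side.
  leaf⇒tip : 2 ≤ w → ∀ {x} → x ∈ leaves → ∃[ i ] x ≡ place (fromℕ m) i
  leaf⇒tip (s≤s (s≤s _)) {zero} leaf = contradiction leaf
    (two-neighbours⇒¬leaf (adj-outward zero zero) (adj-outward zero (suc zero))
      (λ eq → 0≢1 (combine-injectiveʳ {suc m} zero _ zero _ (suc-injective eq))))
    where
    0≢1 : ∀ {k} → _≢_ {A = Fin (suc (suc k))} zero (suc zero)
    0≢1 ()
  leaf⇒tip _ {suc v} leaf with j , i , refl ← combine-surjective {suc m} v with view j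
  ... | ‵fromℕ     = i , refl
  ... | ‵inject₁ j = contradiction leaf
    (two-neighbours⇒¬leaf {place (inject₁ j) i} (adj-inward (inject₁ j) i) (adj-outward (suc j) i)
      (λ eq → ℕ.<⇒≢ (ℕ.≤-<-trans (inward≤ (inject₁ j) i) (ℕ.m<n⇒m<1+n (inward≤ (suc j) i)))
                    (cong toℕ eq)))

  leafCount≤ : 2 ≤ w → leafCount ≤ w
  leafCount≤ 2≤w = covered⇒∣p∣≤ leaves (place (fromℕ m)) (leaf⇒tip 2≤w)

  module Segments (Q : Fin (suc m) → Fin w → Bool)
                  (Q-inward : ∀ j i → T (Q (suc j) i) → T (Q (inject₁ j) i)) where

    contains : Node → Bool
    -- The centre joins the segments and keeps the subtree nonempty when all of them are empty.
    contains zero    = true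
    contains (suc v) = uncurry Q (remQuot {suc m} w v)

    contains-place : ∀ j i → contains (place j i) ≡ Q j i
    contains-place j i = cong (uncurry Q) (remQuot-combine {suc m} j i)

    contains-inward : ∀ j i → T (Q j i) → T (contains (inward j i))
    contains-inward zero    i _ = tt
    contains-inward (suc j) i t = subst T (sym (contains-place (inject₁ j) i)) (Q-inward j i t)

    contains-parent : ∀ v → T (contains (suc v)) → T (contains (parent v))
    contains-parent v = uncurry contains-inward (remQuot {suc m} w v)

    subtree : Subtree tree
    subtree = rootedSubtree contains tt contains-parent

    place∈subtree : ∀ j i → T (Q j i) ⇔ (place j i ∈ Subtree.vertices subtree)
    place∈subtree j i = mk⇔
      (∈-tabulate⁺ contains ∘ subst T (sym (contains-place j i)))
      (subst T (contains-place j i) ∘ ∈-tabulate⁻ contains)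

-- Representing a digraph

p⊆q∧∣q∣≤∣p∣⇒q⊆p : ∀ {n} {p q : Subset n} → p ⊆ q → ∣ q ∣ ≤ ∣ p ∣ → q ⊆ p
p⊆q∧∣q∣≤∣p∣⇒q⊆p {p = p} p⊆q ∣q∣≤∣p∣ {x} x∈q with x ∈? p
... | yes x∈p = x∈p
... | no  x∉p = contradiction (p⊂q⇒∣p∣<∣q∣ (p⊆q , x , x∈q , x∉p)) (ℕ.≤⇒≯ ∣q∣≤∣p∣)

module _ (D : Digraph) where
  open Digraph D

  -- The preorder lives on vertices. Those with equal predecessor sets are comparable, so an
  -- antichain of vertices is one of distinct sets.
  module InclusionOrder = Dilworth (_⊆_ on N⁻) ⊆-refl ⊆-trans (λ u v → N⁻ u ⊆? N⁻ v)
  open InclusionOrder using (Comparable; dilworth; module ChainCover)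

  -- The antichain that comes with the `k` chains shows `k ≤ w`, so the chains can be indexed by
  -- `Fin w`.
  chainColouring : ∀ {w} → IsWidth (incidencePoset D) w →
                   Σ[ c ∈ (Vertex → Fin w) ] (∀ u v → c u ≡ c v → Comparable u v)
  chainColouring {w} (_ , greatest) with k , C , A , _ , incomp ← dilworth ⊤ =
    (λ v → inject≤ (index (∈⊤ {x = v})) k≤w) ,
    (λ u v eq → same-index⇒comparable ∈⊤ ∈⊤ (inject≤-injective k≤w k≤w _ _ eq))
    where
    open ChainCover C
    k≤w : k ≤ w
    k≤w = greatest k (record { element = λ i → N⁻ (A i) , A i , refl ; incomparable = incomp })

  module SpiderRepresentation {w} (c : Vertex → Fin w) (c-chain : ∀ u v → c u ≡ c v → Comparable u v) where
    open Spider w order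

    -- Depths range from 0 to `order`, whence the `suc order` places on each leg. Vertices of one
    -- colour with equal sets share a node.
    depth : Vertex → ℕ
    depth v = order ∸ ∣ N⁻ v ∣

    position : Vertex → Fin (suc order)
    position v = fromℕ< (s≤s (ℕ.m∸n≤m order ∣ N⁻ v ∣))

    toℕ-position : ∀ v → toℕ (position v) ≡ depth v
    toℕ-position v = toℕ-fromℕ< _

    -- Within a chain, cardinality decides inclusion: if `N⁻ v` is the smaller set and yet has at
    -- least as many elements, the two sets coincide.
    N⁻⊆-inward : ∀ {v v′} → c v ≡ c v′ → depth v ≤ depth v′ → N⁻ v′ ⊆ N⁻ v
    N⁻⊆-inward {v} {v′} eq le with c-chain v v′ eq
    ... | inj₁ v⊆v′ = p⊆q∧∣q∣≤∣p∣⇒q⊆p v⊆v′ (ℕ.∸-cancelʳ-≤ (∣p∣≤n (N⁻ v′)) le)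
    ... | inj₂ v′⊆v = v′⊆v

    -- Asking for some caught vertex at distance `j` or further describes the segment up to the
    -- outermost caught sink without computing a maximum.
    CaughtBeyond : Vertex → Fin (suc order) → Fin w → Pred Vertex _
    CaughtBeyond u j i v = Edge u v × c v ≡ i × toℕ j ≤ depth v

    caughtBeyond? : ∀ u j i → Dec (∃ (CaughtBeyond u j i))
    caughtBeyond? u j i = any? (λ v → T? (edge u v) ×-dec c v ≟ i ×-dec toℕ j ℕ.≤? depth v)

    reaches : Vertex → Fin (suc order) → Fin w → Bool
    reaches u j i = ⌊ caughtBeyond? u j i ⌋

    reaches-inward : ∀ u j i → T (reaches u (suc j) i) → T (reaches u (inject₁ j) i)
    reaches-inward u j i t with v , uv , cv≡i , le ← toWitness {a? = caughtBeyond? u (suc j) i} t =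
      fromWitness (v , uv , cv≡i , ℕ.≤-trans (ℕ.≤-trans (ℕ.≤-reflexive (toℕ-inject₁ j)) (ℕ.n≤1+n _)) le)

    reaches-sink⁺ : ∀ u v → Edge u v → T (reaches u (position v) (c v))
    reaches-sink⁺ u v uv = fromWitness (v , uv , refl , ℕ.≤-reflexive (toℕ-position v))

    -- The witness `v′` is on the leg of `v` and at least as deep, so `N⁻ v′`, which contains `u`,
    -- is included in `N⁻ v`.
    reaches-sink⁻ : ∀ u v → T (reaches u (position v) (c v)) → Edge u v
    reaches-sink⁻ u v t
      with v′ , uv′ , eq , le ← toWitness {a? = caughtBeyond? u (position v) (c v)} t =
      ∈-tabulate⁻ (λ u → edge u v)
        (N⁻⊆-inward (sym eq) (subst (_≤ depth v′) (toℕ-position v) le)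
          (∈-tabulate⁺ (λ u → edge u v′) uv′))

    representation : CatchTreeRepresentation D tree
    representation = record
      { source = subtree
      ; sink   = λ v → place (position v) (c v)
      ; catch  = λ u v → mk⇔
          (to (place∈subtree u (position v) (c v)) ∘ reaches-sink⁺ u v)
          (reaches-sink⁻ u v ∘ from (place∈subtree u (position v) (c v)))
      }
      where open module S u = Segments (reaches u) (reaches-inward u)

theorem8 : (D : Digraph) (w l : ℕ) → IsWidth (incidencePoset D) w → IsCatchLeafage D l → 2 ≤ w → l ≤ w
theorem8 D w l width (_ , least) 2≤w with c , c-chain ← chainColouring D width =
  ℕ.≤-trans (least _ (tree , representation , refl)) (leafCount≤ 2≤w)
  where
  open Spider w (Digraph.order D)
  open SpiderRepresentation D c c-chain
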